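{- Let $k,d,q\geq 2$ be integers. There is a function $\varepsilon_{k,d,q}(n)$ with $\varepsilon_{k,d,q}(n) \to 0$ as $n\to\infty$ such that every $k$-uniform hypergraph $H$ on $n$ vertices with $d_1(H)=d$ satisfies $r(H;q)\leq n^{1+\varepsilon_{k,d,q}(n)}$.
   Context: The $q$-color Ramsey number $r(H;q)$ is the minimum $N$ such that every $q$-coloring of the edges of the complete $k$-uniform hypergraph $K_N^{(k)}$ contains a monochromatic copy of $H$. The skeletal degeneracy $d_1(H)$ is the degeneracy of the $1$-skeleton of $H$ (the graph on $V(H)$ joining two vertices iff they lie in a common edge of $H$), i.e. the least $d$ such that every subgraph of that graph has minimum degree at most $d$. -}

module Defs where

open import Data.Nat using (ℕ; _≤_)
open import Data.Bool using (Bool; true; _∧_; not)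
open import Data.Fin using (Fin; _≟_)
open import Data.Fin.Subset using (Subset; ∣_∣; _∩_; _∈_; Nonempty)
open import Data.Vec using (lookup; tabulate)
open import Data.List using (List; allFin)
open import Data.Bool.ListAction using (any)
open import Data.List.Relation.Unary.All using (All)
open import Data.Product using (Σ; ∃; _×_)
open import Relation.Nullary.Decidable using (⌊_⌋)
open import Relation.Binary.PropositionalEquality using (_≡_)
open import Function.Definitions using (Injective)

Hypergraph : ℕ → Set
Hypergraph n = List (Subset n)

Uniform : ∀ {n} → ℕ → Hypergraph n → Set
Uniform k H = All (λ e → ∣ e ∣ ≡ k) H

skelNbhd : ∀ {n} → Hypergraph n → Fin n → Subset n
skelNbhd H v = tabulate (λ u → not ⌊ u ≟ v ⌋ ∧ any (λ e → lookup e u ∧ lookup e v) H)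

SkelDegenAtMost : ∀ {n} → Hypergraph n → ℕ → Set
SkelDegenAtMost {n} H d =
  (S : Subset n) → Nonempty S → Σ (Fin n) (λ v → v ∈ S × ∣ skelNbhd H v ∩ S ∣ ≤ d)

SkelDegeneracy : ∀ {n} → Hypergraph n → ℕ → Set
SkelDegeneracy H d = SkelDegenAtMost H d × (∀ d' → SkelDegenAtMost H d' → d ≤ d')

image : ∀ {n N} → (Fin n → Fin N) → Subset n → Subset N
image {n} f e = tabulate (λ y → any (λ x → lookup e x ∧ ⌊ f x ≟ y ⌋) (allFin n))

-- A q-colouring of the edges of K_N^(k): a colour for every k-subset of Fin N
-- (values on subsets of other sizes are irrelevant).
-- Arrows q k N H : every q-colouring of K_N^(k) has a monochromatic copy of H.
Arrows : ℕ → ℕ → (N : ℕ) → ∀ {n} → Hypergraph n → Set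
Arrows q k N {n} H =
  (c : Subset N → Fin q) →
  Σ (Fin n → Fin N) (λ f → Injective _≡_ _≡_ f ×
    Σ (Fin q) (λ i → All (λ e → c (image f e) ≡ i) H))

-- r(H;q) ≤ M  (r is the minimum N with Arrows, so this means some N ≤ M arrows).
RamseyAtMost : ℕ → ℕ → ∀ {n} → Hypergraph n → ℕ → Set
RamseyAtMost q k H M = Σ ℕ (λ N → N ≤ M × Arrows q k N H)

{-# OPTIONS --safe #-}

-- Let r = d + 1, let χ be a proper r-colouring of the skeleton of H, and let t
-- be a large constant.  By Ramsey's theorem, for a suitable constant R, every
-- g ∈ [N]^R contains r blocks T_1, …, T_r of t coordinates such that all edges
-- across different blocks have the same colour.  Embed H vertex by vertex in
-- degeneracy order, keeping every edge of that colour whenever its unembedded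
-- vertices are replaced by representatives of their blocks.  The candidates for
-- the next vertex v form a set B that is determined by the images of the at most
-- d embedded neighbours of v and by the blocks other than T_χ(v), and by the
-- invariant T_χ(v) lies in B.  So the embedding only fails if |B| < n, and then
-- all t coordinates of T_χ(v) hit a set of density below n/N.  For t large, a
-- union bound over the O(N^(d+1)) possible data produces a g for which this
-- never happens, as soon as N = n^(1+ε).
module Submission where

open import Defs
open import Data.Bool using (true; if_then_else_; not; _∧_)
open import Data.Bool.Properties using (T-∧; T-≡)
open import Data.Fin using (Fin; zero; suc; combine; _↑ˡ_; _↑ʳ_)
import Data.Fin as Fin
import Data.Fin.Properties as Fin
open import Data.Fin.Subset
  using (Subset; inside; outside; ∣_∣; _∈_; _∉_; _⊆_; _∩_; _∪_; _-_; ⁅_⁆; ⊥; ⊤; Empty)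
open import Data.Fin.Subset.Properties
open import Data.List
  using (List; []; _∷_; length; allFin; cartesianProduct; cartesianProductWith; filter)
import Data.List as List
open import Data.List.Properties
  using (length-++; length-map; length-tabulate; map-tabulate; map-++; map-∘; map-cong)
open import Data.List.Membership.Propositional using (find; lose) renaming (_∈_ to _∈ₗ_)
open import Data.List.Membership.Propositional.Properties
  using (∈-allFin; ∈-map⁺; ∈-++⁺ˡ; ∈-++⁺ʳ; ∈-cartesianProduct⁺; ∈-cartesianProductWith⁺; ∈-filter⁺)
open import Data.List.Relation.Unary.All using (All)
import Data.List.Relation.Unary.All as All
import Data.List.Relation.Unary.All.Properties as All
open import Data.List.Relation.Unary.Any using (here; there)
open import Data.List.Relation.Unary.Any.Properties using (any⁺; any⁻)
open import Data.Nat
open import Data.Nat.ListAction using (sum)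
open import Data.Nat.ListAction.Properties using (sum-++)
open import Data.Nat.Properties
open import Algebra.Properties.CommutativeSemigroup +-commutativeSemigroup
  using () renaming (interchange to +-interchange)
open import Algebra.Properties.CommutativeSemigroup *-commutativeSemigroup
  using (x∙yz≈y∙xz) renaming (interchange to *-interchange)
open import Data.Nat.Solver using (module +-*-Solver)
open import Data.Product using (Σ; ∃; ∃-syntax; _×_; _,_; proj₁; proj₂)
open import Data.Sum using (inj₁; inj₂)
open import Data.Unit using (tt) renaming (⊤ to Unit)
open import Data.Vec using (Vec; []; _∷_; lookup; tabulate; zipWith; replicate; _++_; _[_]≔_)
import Data.Vec as Vec
open import Data.Vec.Functional using (updateAt)
open import Data.Vec.Functional.Properties using (updateAt-updates; updateAt-minimal)
open import Data.Vec.Properties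
  using (lookup∘tabulate; lookup⇒[]=; []=⇒lookup; lookup-zipWith; lookup-++ˡ; lookup-++ʳ;
         lookup∘updateAt; lookup∘updateAt′; lookup-replicate)
open import Function using (_∘_; id; Equivalence)
open import Function.Definitions using (Injective)
open import Relation.Binary.PropositionalEquality
open import Relation.Nullary using (¬_; Dec; yes; no; contradiction)
open import Relation.Nullary.Decidable using (⌊_⌋; toWitness; fromWitness; _→-dec_)
open import Relation.Unary using (Decidable)

-- Images and cardinalities of finite sets

module _ {n N : ℕ} (f : Fin n → Fin N) where

  ∈-image⁺ : ∀ {e x} → x ∈ e → f x ∈ image f e
  ∈-image⁺ {e} {x} x∈e = lookup⇒[]= _ _ (trans (lookup∘tabulate _ (f x)) (Equivalence.to T-≡
    (any⁺ _ (lose (∈-allFin x)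
      (Equivalence.from T-∧ (Equivalence.from T-≡ ([]=⇒lookup x∈e) , fromWitness refl))))))

  ∈-image⁻ : ∀ {e y} → y ∈ image f e → ∃[ x ] x ∈ e × f x ≡ y
  ∈-image⁻ {e} {y} y∈ with find (any⁻ _ (allFin n)
      (Equivalence.from T-≡ (trans (sym (lookup∘tabulate _ y)) ([]=⇒lookup y∈))))
  ... | x , _ , p with Equivalence.to (T-∧ {lookup e x}) p
  ... | q , r = x , lookup⇒[]= _ _ (Equivalence.to T-≡ q) , toWitness r

image-∘ : ∀ {n m N} (g : Fin m → Fin N) (f : Fin n → Fin m) e →
          image (g ∘ f) e ≡ image g (image f e)
image-∘ g f e = ⊆-antisym to from
  where
  to : image (g ∘ f) e ⊆ image g (image f e)
  to y∈ with ∈-image⁻ (g ∘ f) {e} y∈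
  ... | x , x∈e , refl = ∈-image⁺ g (∈-image⁺ f x∈e)
  from : image g (image f e) ⊆ image (g ∘ f) e
  from y∈ with ∈-image⁻ g {image f e} y∈
  ... | _ , z∈ , refl with ∈-image⁻ f {e} z∈
  ... | x , x∈e , refl = ∈-image⁺ (g ∘ f) x∈e

image-cong : ∀ {n N} {f g : Fin n → Fin N} e → (∀ {x} → x ∈ e → f x ≡ g x) → image f e ≡ image g e
image-cong {f = f} {g} e f≡g = ⊆-antisym (half f g f≡g) (half g f (sym ∘ f≡g))
  where
  half : ∀ f g → (∀ {x} → x ∈ e → f x ≡ g x) → image f e ⊆ image g e
  half f g f≡g y∈ with ∈-image⁻ f {e} y∈
  ... | x , x∈e , refl = subst (_∈ image g e) (sym (f≡g x∈e)) (∈-image⁺ g x∈e)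

image-outside : ∀ {n N} (f : Fin (suc n) → Fin N) e → image f (outside ∷ e) ≡ image (f ∘ suc) e
image-outside f e = ⊆-antisym to from
  where
  to : image f (outside ∷ e) ⊆ image (f ∘ suc) e
  to y∈ with ∈-image⁻ f {outside ∷ e} y∈
  ... | suc x , Vec.there x∈e , refl = ∈-image⁺ (f ∘ suc) x∈e
  from : image (f ∘ suc) e ⊆ image f (outside ∷ e)
  from y∈ with ∈-image⁻ (f ∘ suc) {e} y∈
  ... | x , x∈e , refl = ∈-image⁺ f (Vec.there x∈e)

image-inside : ∀ {n N} (f : Fin (suc n) → Fin N) e →
               image f (inside ∷ e) ≡ ⁅ f zero ⁆ ∪ image (f ∘ suc) e
image-inside f e = ⊆-antisym to from
  where
  to : image f (inside ∷ e) ⊆ ⁅ f zero ⁆ ∪ image (f ∘ suc) e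
  to y∈ with ∈-image⁻ f {inside ∷ e} y∈
  ... | zero  , _ , refl = x∈p∪q⁺ (inj₁ (x∈⁅x⁆ _))
  ... | suc x , Vec.there x∈e , refl = x∈p∪q⁺ (inj₂ (∈-image⁺ (f ∘ suc) x∈e))
  from : ⁅ f zero ⁆ ∪ image (f ∘ suc) e ⊆ image f (inside ∷ e)
  from y∈ with x∈p∪q⁻ ⁅ f zero ⁆ _ y∈
  ... | inj₁ y∈₁ with refl ← x∈⁅y⁆⇒x≡y _ y∈₁ = ∈-image⁺ f {inside ∷ e} Vec.here
  ... | inj₂ y∈₂ with ∈-image⁻ (f ∘ suc) {e} y∈₂
  ... | x , x∈e , refl = ∈-image⁺ f (Vec.there x∈e)

∣⁅x⁆∪p∣≤1+∣p∣ : ∀ {n} (x : Fin n) p → ∣ ⁅ x ⁆ ∪ p ∣ ≤ suc ∣ p ∣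
∣⁅x⁆∪p∣≤1+∣p∣ zero    (s ∷ p)       rewrite ∪-identityˡ p = s≤s (∣p∣≤∣x∷p∣ s p)
∣⁅x⁆∪p∣≤1+∣p∣ (suc x) (inside ∷ p)  = s≤s (∣⁅x⁆∪p∣≤1+∣p∣ x p)
∣⁅x⁆∪p∣≤1+∣p∣ (suc x) (outside ∷ p) = ∣⁅x⁆∪p∣≤1+∣p∣ x p

x∉p⇒∣⁅x⁆∪p∣≡1+∣p∣ : ∀ {n} (x : Fin n) p → x ∉ p → ∣ ⁅ x ⁆ ∪ p ∣ ≡ suc ∣ p ∣
x∉p⇒∣⁅x⁆∪p∣≡1+∣p∣ zero    (inside ∷ p)  x∉p = contradiction Vec.here x∉p
x∉p⇒∣⁅x⁆∪p∣≡1+∣p∣ zero    (outside ∷ p) x∉p rewrite ∪-identityˡ p = refl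
x∉p⇒∣⁅x⁆∪p∣≡1+∣p∣ (suc x) (inside ∷ p)  x∉p = cong suc (x∉p⇒∣⁅x⁆∪p∣≡1+∣p∣ x p (x∉p ∘ Vec.there))
x∉p⇒∣⁅x⁆∪p∣≡1+∣p∣ (suc x) (outside ∷ p) x∉p = x∉p⇒∣⁅x⁆∪p∣≡1+∣p∣ x p (x∉p ∘ Vec.there)

∣image∣≤∣e∣ : ∀ {n N} (f : Fin n → Fin N) e → ∣ image f e ∣ ≤ ∣ e ∣
∣image∣≤∣e∣ {N = N} f [] = ≤-reflexive
  (trans (cong ∣_∣ (⊆-antisym {j = ⊥} to (λ y∈ → contradiction y∈ ∉⊥))) (∣⊥∣≡0 N))
  where
  to : image f [] ⊆ ⊥
  to y∈ with () ← proj₁ (∈-image⁻ f {[]} y∈)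
∣image∣≤∣e∣ f (outside ∷ e) rewrite image-outside f e = ∣image∣≤∣e∣ (f ∘ suc) e
∣image∣≤∣e∣ f (inside ∷ e) rewrite image-inside f e =
  ≤-trans (∣⁅x⁆∪p∣≤1+∣p∣ (f zero) _) (s≤s (∣image∣≤∣e∣ (f ∘ suc) e))

InjectiveOn : ∀ {n N} → Subset n → (Fin n → Fin N) → Set
InjectiveOn e f = ∀ {x y} → x ∈ e → y ∈ e → f x ≡ f y → x ≡ y

∣image∣≡∣e∣ : ∀ {n N} (f : Fin n → Fin N) e → InjectiveOn e f → ∣ image f e ∣ ≡ ∣ e ∣
∣image∣≡∣e∣ f [] inj = n≤0⇒n≡0 (∣image∣≤∣e∣ f [])
∣image∣≡∣e∣ f (outside ∷ e) inj rewrite image-outside f e =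
  ∣image∣≡∣e∣ (f ∘ suc) e λ x∈ y∈ eq → Fin.suc-injective (inj (Vec.there x∈) (Vec.there y∈) eq)
∣image∣≡∣e∣ f (inside ∷ e) inj rewrite image-inside f e =
  trans (x∉p⇒∣⁅x⁆∪p∣≡1+∣p∣ (f zero) _ f0∉)
    (cong suc (∣image∣≡∣e∣ (f ∘ suc) e λ x∈ y∈ eq →
      Fin.suc-injective (inj (Vec.there x∈) (Vec.there y∈) eq)))
  where
  f0∉ : f zero ∉ image (f ∘ suc) e
  f0∉ f0∈ with ∈-image⁻ (f ∘ suc) {e} f0∈
  ... | x , x∈e , eq with () ← inj (Vec.there x∈e) Vec.here eq

∣p∣<∣q∣⇒q⊈p : ∀ {n} (p q : Subset n) → ∣ p ∣ < ∣ q ∣ → ∃[ x ] x ∈ q × x ∉ p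
∣p∣<∣q∣⇒q⊈p (outside ∷ p) (inside ∷ q) _ = zero , Vec.here , λ ()
∣p∣<∣q∣⇒q⊈p (outside ∷ p) (outside ∷ q) lt with ∣p∣<∣q∣⇒q⊈p p q lt
... | x , x∈q , x∉p = suc x , Vec.there x∈q , x∉p ∘ drop-there
∣p∣<∣q∣⇒q⊈p (inside ∷ p) (inside ∷ q) (s≤s lt) with ∣p∣<∣q∣⇒q⊈p p q lt
... | x , x∈q , x∉p = suc x , Vec.there x∈q , x∉p ∘ drop-there
∣p∣<∣q∣⇒q⊈p (inside ∷ p) (outside ∷ q) lt with ∣p∣<∣q∣⇒q⊈p p q (<-trans (n<1+n _) lt)
... | x , x∈q , x∉p = suc x , Vec.there x∈q , x∉p ∘ drop-there

-- Ramsey's theorem for hypergraphs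

-- An m-subset of `Fin n`, encoded as the order-preserving embedding that enumerates it. Subsets are
-- then pushed forward by plain recursion (`act`), which suits arguments on the least element.
data OPE : ℕ → ℕ → Set where
  done : OPE 0 0
  skip : ∀ {m n} → OPE m n → OPE m (suc n)
  keep : ∀ {m n} → OPE m n → OPE (suc m) (suc n)

idₒ : ∀ n → OPE n n
idₒ zero    = done
idₒ (suc n) = keep (idₒ n)

emptyₒ : ∀ n → OPE 0 n
emptyₒ zero    = done
emptyₒ (suc n) = skip (emptyₒ n)

infixr 9 _∘ₒ_
_∘ₒ_ : ∀ {l m n} → OPE m n → OPE l m → OPE l n
done   ∘ₒ p      = p
skip o ∘ₒ p      = skip (o ∘ₒ p)
keep o ∘ₒ skip p = skip (o ∘ₒ p)
keep o ∘ₒ keep p = keep (o ∘ₒ p)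

act : ∀ {m n} → OPE m n → Subset m → Subset n
act done     W       = W
act (skip o) W       = outside ∷ act o W
act (keep o) (b ∷ W) = b ∷ act o W

index : ∀ {m n} → OPE m n → Fin m → Fin n
index (skip o) i       = suc (index o i)
index (keep o) zero    = zero
index (keep o) (suc i) = suc (index o i)

act-id : ∀ {n} (W : Subset n) → act (idₒ n) W ≡ W
act-id []      = refl
act-id (b ∷ W) = cong (b ∷_) (act-id W)

act-∘ : ∀ {l m n} (o : OPE m n) (p : OPE l m) W → act (o ∘ₒ p) W ≡ act o (act p W)
act-∘ done     p        W       = refl
act-∘ (skip o) p        W       = cong (outside ∷_) (act-∘ o p W)
act-∘ (keep o) (skip p) W       = cong (outside ∷_) (act-∘ o p W)
act-∘ (keep o) (keep p) (b ∷ W) = cong (b ∷_) (act-∘ o p W)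

∣act∣ : ∀ {m n} (o : OPE m n) W → ∣ act o W ∣ ≡ ∣ W ∣
∣act∣ done     W             = refl
∣act∣ (skip o) W             = ∣act∣ o W
∣act∣ (keep o) (inside ∷ W)  = cong suc (∣act∣ o W)
∣act∣ (keep o) (outside ∷ W) = ∣act∣ o W

index-injective : ∀ {m n} (o : OPE m n) → Injective _≡_ _≡_ (index o)
index-injective (skip o) eq = index-injective o (Fin.suc-injective eq)
index-injective (keep o) {zero}  {zero}  eq = refl
index-injective (keep o) {suc i} {suc j} eq = cong suc (index-injective o (Fin.suc-injective eq))

∈-act⁺ : ∀ {m n} (o : OPE m n) {W x} → x ∈ W → index o x ∈ act o W
∈-act⁺ (skip o) x∈W             = Vec.there (∈-act⁺ o x∈W)
∈-act⁺ (keep o) Vec.here        = Vec.here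
∈-act⁺ (keep o) (Vec.there x∈W) = Vec.there (∈-act⁺ o x∈W)

∈-act⁻ : ∀ {m n} (o : OPE m n) W {y} → y ∈ act o W → ∃[ x ] x ∈ W × index o x ≡ y
∈-act⁻ (skip o) W (Vec.there y∈) with ∈-act⁻ o W y∈
... | x , x∈W , refl = x , x∈W , refl
∈-act⁻ (keep o) (inside ∷ W) Vec.here = zero , Vec.here , refl
∈-act⁻ (keep o) (_ ∷ W) (Vec.there y∈) with ∈-act⁻ o W y∈
... | x , x∈W , refl = suc x , Vec.there x∈W , refl

act≡image : ∀ {m n} (o : OPE m n) W → act o W ≡ image (index o) W
act≡image o W = ⊆-antisym to from
  where
  to : act o W ⊆ image (index o) W
  to y∈ with ∈-act⁻ o W y∈
  ... | x , x∈W , refl = ∈-image⁺ (index o) x∈W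
  from : image (index o) W ⊆ act o W
  from y∈ with ∈-image⁻ (index o) {W} y∈
  ... | x , x∈W , refl = ∈-act⁺ o x∈W

Monochrome : ∀ {q m n} → Fin q → OPE m n → Vec (Fin q) n → Set
Monochrome c o cs = ∀ i → lookup cs (index o i) ≡ c

sum-decrement : ∀ {q m} (need : Vec ℕ q) c → lookup need c ≡ suc m →
                Vec.sum need ≡ suc (Vec.sum (need [ c ]≔ m))
sum-decrement (x ∷ need) zero    refl = refl
sum-decrement (x ∷ need) (suc c) eq   = trans (cong (x +_) (sum-decrement need c eq)) (+-suc x _)

-- Pigeonhole with a separate quota for each colour. Reading the head lowers the quota of its colour
-- by one; a colour whose quota is zero is served by the empty selection.
monochrome-subsequence : ∀ {q n} (need : Vec ℕ (suc q)) (cs : Vec (Fin (suc q)) n) →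
  Vec.sum need ≤ n → ∃[ c ] ∃[ o ] Monochrome {m = lookup need c} c o cs
monochrome-subsequence (zero ∷ need) [] _ = zero , done , λ ()
monochrome-subsequence {q} {suc n} need (c ∷ cs) le with lookup need c in eq
... | zero = c , subst (λ m → Σ (OPE m (suc n)) λ o → Monochrome c o (c ∷ cs)) (sym eq)
                   (emptyₒ _ , λ ())
... | suc m with monochrome-subsequence (need [ c ]≔ m) cs
                   (s≤s⁻¹ (≤-trans (≤-reflexive (sym (sum-decrement need c eq))) le))
...   | c′ , o , mono with c′ Fin.≟ c
...     | no c′≢c = c′ , subst (λ m → Σ (OPE m (suc n)) λ o → Monochrome c′ o (c ∷ cs))
                           (lookup∘updateAt′ c′ c c′≢c need) (skip o , mono)
...     | yes refl = c , subst (λ m → Σ (OPE m (suc n)) λ o → Monochrome c o (c ∷ cs))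
                           (trans (cong suc (lookup∘updateAt c need)) (sym eq))
                           (keep o , λ { zero → refl ; (suc i) → mono i })

-- The colour of a (k+1)-set depends only on its least element.
EndHomogeneous : ∀ {q n} → ℕ → (Subset n → Fin q) → Vec (Fin q) n → Set
EndHomogeneous k f []       = Unit
EndHomogeneous k f (c ∷ cs) =
  (∀ W → ∣ W ∣ ≡ k → f (inside ∷ W) ≡ c) × EndHomogeneous k (f ∘ (outside ∷_)) cs

endHomogeneous-cong : ∀ {q n k} {f g : Subset n → Fin q} cs → (∀ W → f W ≡ g W) →
                      EndHomogeneous k f cs → EndHomogeneous k g cs
endHomogeneous-cong []       f≡g _       = tt
endHomogeneous-cong (c ∷ cs) f≡g (h , t) =
  (λ W eq → trans (sym (f≡g _)) (h W eq)) , endHomogeneous-cong cs (f≡g ∘ (outside ∷_)) t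

-- The least element of `act o W` is a position selected by `o`, and there the recorded colour is
-- `c`.
endHomogeneous⇒homogeneous : ∀ {q n s k} {f : Subset n → Fin q} {c} cs (o : OPE s n) →
  EndHomogeneous k f cs → Monochrome c o cs → ∀ W → ∣ W ∣ ≡ suc k → f (act o W) ≡ c
endHomogeneous⇒homogeneous [] done _ _ [] ()
endHomogeneous⇒homogeneous (_ ∷ cs) (skip o) (_ , t) mono W eq =
  endHomogeneous⇒homogeneous cs o t mono W eq
endHomogeneous⇒homogeneous (_ ∷ cs) (keep o) (h , _) mono (inside ∷ W) eq =
  trans (h (act o W) (trans (∣act∣ o W) (suc-injective eq))) (mono zero)
endHomogeneous⇒homogeneous (_ ∷ cs) (keep o) (_ , t) mono (outside ∷ W) eq =
  endHomogeneous⇒homogeneous cs o t (mono ∘ suc) W eq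

Ramsey : ℕ → ℕ → ℕ → ℕ → Set
Ramsey q k s R = (f : Subset R → Fin q) →
  ∃[ c ] Σ (OPE s R) λ o → ∀ W → ∣ W ∣ ≡ k → f (act o W) ≡ c

-- Set the first vertex aside. The sets containing it induce a colouring of the k-subsets of the
-- rest, and Ramsey's theorem for k leaves a homogeneous set large enough to repeat the argument
-- inside it.
endHomogeneous-exists : ∀ {q k} → (∀ s → ∃ (Ramsey q k s)) → ∀ l →
  ∃[ R ] ((f : Subset R → Fin q) → Σ (OPE l R) λ o → ∃[ cs ] EndHomogeneous k (f ∘ act o) cs)
endHomogeneous-exists ramseyₖ zero = 0 , λ f → done , [] , tt
endHomogeneous-exists {q} {k} ramseyₖ (suc l) with endHomogeneous-exists ramseyₖ l
... | R₁ , extract with ramseyₖ R₁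
... | R₂ , arrows = suc R₂ , result
  where
  result : (f : Subset (suc R₂) → Fin q) →
           Σ (OPE (suc l) (suc R₂)) λ o → ∃[ cs ] EndHomogeneous k (f ∘ act o) cs
  result f with arrows (f ∘ (inside ∷_))
  ... | c , o₁ , hom with extract (f ∘ (outside ∷_) ∘ act o₁)
  ... | o₂ , cs , end = keep (o₁ ∘ₒ o₂) , c ∷ cs ,
    (λ W eq → trans (cong (f ∘ (inside ∷_)) (act-∘ o₁ o₂ W))
                    (hom (act o₂ W) (trans (∣act∣ o₂ W) eq))) ,
    endHomogeneous-cong cs (λ W → cong (f ∘ (outside ∷_)) (sym (act-∘ o₁ o₂ W))) end

-- Induction on the uniformity: make the colour depend only on the least element along a sequence of
-- length (q+1)s, then apply the pigeonhole principle to the recorded colours.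
ramsey : ∀ q k s → ∃ (Ramsey (suc q) k s)
ramsey q zero s = s , λ f → f ⊥ , idₒ s , λ W eq → cong f (trans (act-id W) (∣W∣≡0⇒W≡⊥ W eq))
  where
  ∣W∣≡0⇒W≡⊥ : ∀ {n} (W : Subset n) → ∣ W ∣ ≡ 0 → W ≡ ⊥
  ∣W∣≡0⇒W≡⊥ []            _  = refl
  ∣W∣≡0⇒W≡⊥ (outside ∷ W) eq = cong (outside ∷_) (∣W∣≡0⇒W≡⊥ W eq)
ramsey q (suc k) s with endHomogeneous-exists (ramsey q k) (Vec.sum (replicate (suc q) s))
... | R , extract = R , result
  where
  result : Ramsey (suc q) (suc k) s R
  result f with extract f
  ... | o₁ , cs , end with monochrome-subsequence (replicate (suc q) s) cs ≤-refl
  ... | c , o₂ , mono =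
    c , subst (λ s → Σ (OPE s R) λ o → ∀ W → ∣ W ∣ ≡ suc k → f (act o W) ≡ c)
      (lookup-replicate c s)
      (o₁ ∘ₒ o₂ , λ W eq →
        trans (cong f (act-∘ o₁ o₂ W)) (endHomogeneous⇒homogeneous cs o₂ end mono W eq))

-- Counting

∑ : {A : Set} → List A → (A → ℕ) → ℕ
∑ xs f = sum (List.map f xs)

module _ {A : Set} where

  ∑-mono : ∀ (xs : List A) {f g : A → ℕ} → (∀ x → f x ≤ g x) → ∑ xs f ≤ ∑ xs g
  ∑-mono []       f≤g = z≤n
  ∑-mono (x ∷ xs) f≤g = +-mono-≤ (f≤g x) (∑-mono xs f≤g)

  ∑-const : ∀ (xs : List A) c → ∑ xs (λ _ → c) ≡ length xs * c
  ∑-const []       c = refl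
  ∑-const (_ ∷ xs) c = cong (c +_) (∑-const xs c)

  ∑-zero : ∀ (xs : List A) → ∑ xs (λ _ → 0) ≡ 0
  ∑-zero xs = trans (∑-const xs 0) (*-zeroʳ (length xs))

  ∑-*ʳ : ∀ (xs : List A) f c → ∑ xs f * c ≡ ∑ xs (λ x → f x * c)
  ∑-*ʳ []       f c = refl
  ∑-*ʳ (x ∷ xs) f c = trans (*-distribʳ-+ c (f x) _) (cong (f x * c +_) (∑-*ʳ xs f c))

  ∑-+ : ∀ (xs : List A) f g → ∑ xs (λ x → f x + g x) ≡ ∑ xs f + ∑ xs g
  ∑-+ []       f g = refl
  ∑-+ (x ∷ xs) f g = trans (cong (f x + g x +_) (∑-+ xs f g)) (+-interchange (f x) (g x) _ _)

  ∑-++ : ∀ (xs ys : List A) f → ∑ (xs List.++ ys) f ≡ ∑ xs f + ∑ ys f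
  ∑-++ xs ys f = trans (cong sum (map-++ f xs ys)) (sum-++ (List.map f xs) (List.map f ys))

  ∑-map : ∀ {B : Set} (h : B → A) xs f → ∑ (List.map h xs) f ≡ ∑ xs (f ∘ h)
  ∑-map h xs f = cong sum (sym (map-∘ xs))

  ∑-cong : ∀ (xs : List A) {f g : A → ℕ} → (∀ x → f x ≡ g x) → ∑ xs f ≡ ∑ xs g
  ∑-cong xs f≡g = cong sum (map-cong f≡g xs)

  ∑<length⇒∃zero : ∀ (xs : List A) f → ∑ xs f < length xs → ∃[ x ] f x ≡ 0
  ∑<length⇒∃zero (x ∷ xs) f lt with f x in eq
  ... | zero  = x , eq
  ... | suc m = ∑<length⇒∃zero xs f (≤-trans (s≤s (m≤n+m _ m)) (s≤s⁻¹ lt))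

  ∑≡0⇒∀zero : ∀ {xs : List A} f → ∑ xs f ≡ 0 → ∀ {x} → x ∈ₗ xs → f x ≡ 0
  ∑≡0⇒∀zero {x ∷ xs} f eq (here refl) = m+n≡0⇒m≡0 (f x) eq
  ∑≡0⇒∀zero {x ∷ xs} f eq (there x∈) = ∑≡0⇒∀zero f (m+n≡0⇒n≡0 (f x) eq) x∈

∑-comm : ∀ {A B : Set} (xs : List A) (ys : List B) (f : A → B → ℕ) →
         ∑ xs (λ x → ∑ ys (f x)) ≡ ∑ ys (λ y → ∑ xs (λ x → f x y))
∑-comm []       ys f = sym (∑-zero ys)
∑-comm (x ∷ xs) ys f = trans (cong (∑ ys (f x) +_) (∑-comm xs ys f)) (sym (∑-+ ys (f x) _))

∑-cartesianProductWith : ∀ {A B C : Set} (h : A → B → C) xs ys f →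
  ∑ (cartesianProductWith h xs ys) f ≡ ∑ xs (λ x → ∑ ys (λ y → f (h x y)))
∑-cartesianProductWith h []       ys f = refl
∑-cartesianProductWith h (x ∷ xs) ys f =
  trans (∑-++ (List.map (h x) ys) _ f)
    (cong₂ _+_ (∑-map (h x) ys f) (∑-cartesianProductWith h xs ys f))

∑-allFin : ∀ {n} (p : Subset n) → ∑ (allFin n) (λ y → if lookup p y then 1 else 0) ≡ ∣ p ∣
∑-allFin []           = refl
∑-allFin {suc n} (s ∷ p) = step s
  where
  indicator = λ b → if b then 1 else 0
  tail : ∑ (List.tabulate {n = n} suc) (indicator ∘ lookup (s ∷ p)) ≡ ∣ p ∣
  tail = trans
    (cong (λ ys → ∑ ys (indicator ∘ lookup (s ∷ p))) (sym (map-tabulate {n = n} id Fin.suc)))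
    (trans (∑-map Fin.suc (allFin n) (indicator ∘ lookup (s ∷ p))) (∑-allFin p))
  step : ∀ b → indicator b + ∑ (List.tabulate {n = n} suc) (indicator ∘ lookup (s ∷ p)) ≡ ∣ b ∷ p ∣
  step inside  = cong suc tail
  step outside = tail

length-cartesianProductWith : ∀ {A B C : Set} (h : A → B → C) xs ys →
  length (cartesianProductWith h xs ys) ≡ length xs * length ys
length-cartesianProductWith h []       ys = refl
length-cartesianProductWith h (x ∷ xs) ys =
  trans (length-++ (List.map (h x) ys))
    (cong₂ _+_ (length-map (h x) ys) (length-cartesianProductWith h xs ys))

vectors : {A : Set} → List A → ∀ n → List (Vec A n)
vectors xs zero    = [] ∷ []
vectors xs (suc n) = cartesianProductWith _∷_ xs (vectors xs n)

length-vectors : ∀ {A : Set} (xs : List A) n → length (vectors xs n) ≡ length xs ^ n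
length-vectors xs zero    = refl
length-vectors xs (suc n) =
  trans (length-cartesianProductWith _∷_ xs (vectors xs n))
    (cong (length xs *_) (length-vectors xs n))

∈-vectors : ∀ {A : Set} {xs : List A} → (∀ x → x ∈ₗ xs) →
            ∀ {n} (v : Vec A n) → v ∈ₗ vectors xs n
∈-vectors x∈ []      = here refl
∈-vectors x∈ (y ∷ v) = ∈-cartesianProductWith⁺ _∷_ (x∈ y) (∈-vectors x∈ v)

sublists : {A : Set} → List A → List (List A)
sublists []       = [] ∷ []
sublists (x ∷ xs) = List.map (x ∷_) (sublists xs) List.++ sublists xs

filter∈sublists : ∀ {A : Set} {P : A → Set} (P? : Decidable P) xs → filter P? xs ∈ₗ sublists xs
filter∈sublists P? []       = here refl
filter∈sublists P? (x ∷ xs) with P? x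
... | yes _ = ∈-++⁺ˡ (∈-map⁺ (x ∷_) (filter∈sublists P? xs))
... | no  _ = ∈-++⁺ʳ (List.map (x ∷_) (sublists xs)) (filter∈sublists P? xs)

-- As a function of `y`, `overwrite P g` retains nothing of the entries of `g` in `P`. Whatever is
-- computed from this function is therefore independent of those entries.
overwrite : ∀ {A : Set} {n} → Subset n → Vec A n → A → Vec A n
overwrite P g y = zipWith (λ s x → if s then y else x) P g

∏ : ∀ {A : Set} {n} → Subset n → Vec A n → (A → ℕ) → ℕ
∏ []            []      f = 1
∏ (inside ∷ P)  (x ∷ g) f = f x * ∏ P g f
∏ (outside ∷ P) (x ∷ g) f = ∏ P g f

∏≡1 : ∀ {A : Set} {n} (P : Subset n) (g : Vec A n) f →
      (∀ {p} → p ∈ P → f (lookup g p) ≡ 1) → ∏ P g f ≡ 1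
∏≡1 []            []      f _ = refl
∏≡1 (inside ∷ P)  (x ∷ g) f h = cong₂ _*_ (h Vec.here) (∏≡1 P g f (h ∘ Vec.there))
∏≡1 (outside ∷ P) (x ∷ g) f h = ∏≡1 P g f (h ∘ Vec.there)

-- D (overwrite P g) does not depend on the coordinates of g in P, so each of
-- them independently costs a factor b out of length xs.
∑∏-bound : ∀ {A : Set} (xs : List A) b {n} (P : Subset n) (D : (A → Vec A n) → A → ℕ) →
  (∀ h → ∑ xs (D h) ≤ b) →
  ∑ (vectors xs n) (λ g → ∏ P g (D (overwrite P g))) * length xs ^ ∣ P ∣ ≤ length xs ^ n * b ^ ∣ P ∣
∑∏-bound xs b [] D le = ≤-refl
∑∏-bound xs b {suc n} (outside ∷ P) D le = begin
  ∑ (vectors xs (suc n)) (λ g → ∏ (outside ∷ P) g (D (overwrite (outside ∷ P) g))) * l ^ ∣ P ∣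
    ≡⟨ cong (_* l ^ ∣ P ∣) (∑-cartesianProductWith _∷_ xs _ _) ⟩
  ∑ xs (λ x → ∑ (vectors xs n) (λ g → ∏ P g (D′ x (overwrite P g)))) * l ^ ∣ P ∣
    ≡⟨ ∑-*ʳ xs _ _ ⟩
  ∑ xs (λ x → ∑ (vectors xs n) (λ g → ∏ P g (D′ x (overwrite P g))) * l ^ ∣ P ∣)
    ≤⟨ ∑-mono xs (λ x → ∑∏-bound xs b P (D′ x) (λ h → le (λ z → x ∷ h z))) ⟩
  ∑ xs (λ _ → l ^ n * b ^ ∣ P ∣)
    ≡⟨ ∑-const xs _ ⟩
  l * (l ^ n * b ^ ∣ P ∣)
    ≡⟨ *-assoc l _ _ ⟨
  l ^ suc n * b ^ ∣ P ∣ ∎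
  where
  open ≤-Reasoning
  l = length xs
  D′ = λ x h → D (λ z → x ∷ h z)
∑∏-bound xs b {suc n} (inside ∷ P) D le = begin
  ∑ (vectors xs (suc n)) (λ g → ∏ (inside ∷ P) g (D (overwrite (inside ∷ P) g))) * l ^ suc ∣ P ∣
    ≡⟨ cong (_* l ^ suc ∣ P ∣) (∑-cartesianProductWith _∷_ xs (vectors xs n) _) ⟩
  ∑ xs (λ x → ∑ (vectors xs n) (λ g → factor g x * rest g)) * l ^ suc ∣ P ∣
    ≡⟨ cong (_* l ^ suc ∣ P ∣) (∑-comm xs (vectors xs n) (λ x g → factor g x * rest g)) ⟩
  ∑ (vectors xs n) (λ g → ∑ xs (λ x → factor g x * rest g)) * l ^ suc ∣ P ∣
    ≡⟨ cong (_* l ^ suc ∣ P ∣) (∑-cong (vectors xs n) (λ g → ∑-*ʳ xs (factor g) (rest g))) ⟨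
  ∑ (vectors xs n) (λ g → ∑ xs (factor g) * rest g) * l ^ suc ∣ P ∣
    ≤⟨ *-monoˡ-≤ (l ^ suc ∣ P ∣) (∑-mono (vectors xs n) (λ g → *-monoˡ-≤ (rest g) (le _))) ⟩
  ∑ (vectors xs n) (λ g → b * rest g) * l ^ suc ∣ P ∣
    ≡⟨ cong (_* l ^ suc ∣ P ∣) (∑-cong (vectors xs n) (λ g → *-comm b (rest g))) ⟩
  ∑ (vectors xs n) (λ g → rest g * b) * l ^ suc ∣ P ∣
    ≡⟨ cong (_* l ^ suc ∣ P ∣) (∑-*ʳ (vectors xs n) rest b) ⟨
  E * b * (l * l ^ ∣ P ∣)
    ≡⟨ solve 4 (λ E b l L → E :* b :* (l :* L) := (l :* b) :* (E :* L)) refl E b l (l ^ ∣ P ∣) ⟩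
  (l * b) * (E * l ^ ∣ P ∣)
    ≤⟨ *-monoʳ-≤ (l * b) (∑∏-bound xs b P D′ (λ h → le (λ z → z ∷ h z))) ⟩
  (l * b) * (l ^ n * b ^ ∣ P ∣)
    ≡⟨ solve 4 (λ l b L B → (l :* b) :* (L :* B) := l :* L :* (b :* B)) refl
         l b (l ^ n) (b ^ ∣ P ∣) ⟩
  l ^ suc n * b ^ suc ∣ P ∣ ∎
  where
  open ≤-Reasoning
  open +-*-Solver
  l = length xs
  -- The first coordinate is overwritten by `z` as well, so neither the function `factor g` nor the
  -- number `rest g` involves the actual entry `x`. Hence the sum over `x` can be split off.
  D′ = λ h → D (λ z → z ∷ h z)
  factor = λ g → D′ (overwrite P g)
  rest = λ g → ∏ P g (factor g)
  E = ∑ (vectors xs n) rest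

-- First moment method: each `w i` has mean at most b/a, so the mean total weight is below 1 and
-- some `g` has total weight 0.
union-bound : ∀ {I A : Set} (es : List I) (gs : List A) (w : I → A → ℕ) a b →
  length es * b < a → .{{NonZero (length gs)}} →
  (∀ i → ∑ gs (w i) * a ≤ length gs * b) → ∃[ g ] (∀ {i} → i ∈ₗ es → w i g ≡ 0)
union-bound es gs w a b small bound = proj₁ avoiding , ∑≡0⇒∀zero (λ i → w i _) (proj₂ avoiding)
  where
  open ≤-Reasoning
  total : ∑ gs (λ g → ∑ es (λ i → w i g)) * a < length gs * a
  total = begin-strict
    ∑ gs (λ g → ∑ es (λ i → w i g)) * a ≡⟨ cong (_* a) (∑-comm gs es (λ g i → w i g)) ⟩
    ∑ es (λ i → ∑ gs (w i)) * a         ≡⟨ ∑-*ʳ es _ a ⟩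
    ∑ es (λ i → ∑ gs (w i) * a)         ≤⟨ ∑-mono es bound ⟩
    ∑ es (λ _ → length gs * b)          ≡⟨ ∑-const es _ ⟩
    length es * (length gs * b)         ≡⟨ x∙yz≈y∙xz (length es) (length gs) b ⟩
    length gs * (length es * b)         <⟨ *-monoʳ-< (length gs) small ⟩
    length gs * a                       ∎
  avoiding : ∃[ g ] ∑ es (λ i → w i g) ≡ 0
  avoiding = ∑<length⇒∃zero gs (λ g → ∑ es (λ i → w i g)) (*-cancelʳ-< a _ _ total)

-- Existence of rich vectors by a union bound

comprehension : ∀ {n} {P : Fin n → Set} → Decidable P → Subset n
comprehension P? = tabulate (λ x → ⌊ P? x ⌋)

∈-comprehension⁺ : ∀ {n} {P : Fin n → Set} (P? : Decidable P) {x} → P x → x ∈ comprehension P?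
∈-comprehension⁺ P? {x} px = lookup⇒[]= x _
  (trans (lookup∘tabulate _ x) (Equivalence.to T-≡ (fromWitness px)))

∈-comprehension⁻ : ∀ {n} {P : Fin n → Set} (P? : Decidable P) {x} → x ∈ comprehension P? → P x
∈-comprehension⁻ P? {x} x∈ = toWitness
  (Equivalence.from T-≡ (trans (sym (lookup∘tabulate _ x)) ([]=⇒lookup x∈)))

subsets : ∀ n → List (Subset n)
subsets = vectors (inside ∷ outside ∷ [])

∈-subsets : ∀ {n} (p : Subset n) → p ∈ₗ subsets n
∈-subsets = ∈-vectors λ { inside → here refl ; outside → there (here refl) }

module _ {P A : Set} {x y : A} where

  if-yes : (P? : Dec P) → P → (if ⌊ P? ⌋ then x else y) ≡ x
  if-yes (yes _) p = refl
  if-yes (no ¬p) p = contradiction p ¬p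

  if-no : (P? : Dec P) → ¬ P → (if ⌊ P? ⌋ then x else y) ≡ y
  if-no (yes p) ¬p = contradiction p ¬p
  if-no (no _)  ¬p = refl

-- A colour, a block and a family of index sets: all the data of a bad event except the tuple `S`.
-- Their number depends on `q`, `R` and `d` alone.
patterns : ∀ q R d → List (Fin q × Subset R × List (Subset (d + R)))
patterns q R d =
  cartesianProduct (allFin q) (cartesianProduct (subsets R) (sublists (subsets (d + R))))

module _ {q N : ℕ} (c : Subset N → Fin q) (R d : ℕ) where

  Pattern : Set
  Pattern = Fin q × Subset R × List (Subset (d + R))

  -- `W` is a set of indices into the pool `S ++ g`: the entries of `S` are images already fixed,
  -- those of `g` are the random coordinates.
  Extends : Fin q → Vec (Fin N) d → Vec (Fin N) R → Subset (d + R) → Set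
  Extends col S g W = c (image (lookup (S ++ g)) W) ≡ col

  extendsAll? : ∀ col S (h : Fin N → Vec (Fin N) R) F →
                Decidable (λ y → All (Extends col S (h y)) F)
  extendsAll? col S h F y = All.all? (λ W → c (image (lookup (S ++ h y)) W) Fin.≟ col) F

  candidates : Pattern → Vec (Fin N) d → (Fin N → Vec (Fin N) R) → Subset N
  candidates (col , _ , F) S h = comprehension (extendsAll? col S h F)

  module _ (n t : ℕ) where

    -- The indicator of the candidate set, set to zero when that set has at least `n` elements. This
    -- makes the bound `n` on its sum unconditional.
    restricted : Pattern → Vec (Fin N) d → (Fin N → Vec (Fin N) R) → Fin N → ℕ
    restricted i S h y =
      if ⌊ ∣ candidates i S h ∣ <? n ⌋ then (if lookup (candidates i S h) y then 1 else 0) else 0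

    weight : Pattern × Vec (Fin N) d → Vec (Fin N) R → ℕ
    weight (i@(_ , P , _) , S) g =
      if ⌊ ∣ P ∣ ≟ t ⌋ then ∏ P g (restricted i S (overwrite P g)) else 0

    ∑-restricted : ∀ i S h → ∑ (allFin N) (restricted i S h) ≤ n
    ∑-restricted i S h with ∣ candidates i S h ∣ <? n
    ... | yes lt = ≤-trans (≤-reflexive (∑-allFin (candidates i S h))) (<⇒≤ lt)
    ... | no  _  = ≤-trans (≤-reflexive (∑-zero (allFin N))) z≤n

    -- Each of the t coordinates in `P` independently falls into a fixed set of fewer than n of the
    -- N vertices, so the mean weight is at most (n/N)^t; denominators are cleared.
    ∑-weight : ∀ i →
      ∑ (vectors (allFin N) R) (weight i) * N ^ t ≤ length (vectors (allFin N) R) * n ^ t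
    ∑-weight (i@(_ , P , _) , S) with ∣ P ∣ ≟ t
    ... | no _ = ≤-trans (≤-reflexive (cong (_* N ^ t) (∑-zero (vectors (allFin N) R)))) z≤n
    ... | yes refl = subst₂
      (λ l L → ∑ (vectors (allFin N) R) (λ g → ∏ P g (restricted i S (overwrite P g))) * l ^ t
               ≤ L * n ^ t)
      (length-tabulate id) (sym (length-vectors (allFin N) R))
      (∑∏-bound (allFin N) n P (restricted i S) (∑-restricted i S))

    -- If the candidate set were small, every factor of the product over `P` would be 1, and so
    -- would the weight.
    weight≡0⇒many : ∀ col P F S g → ∣ P ∣ ≡ t → weight ((col , P , F) , S) g ≡ 0 →
      (∀ {p} → p ∈ P → All (Extends col S (overwrite P g (lookup g p))) F) →
      n ≤ ∣ candidates (col , P , F) S (overwrite P g) ∣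
    weight≡0⇒many col P F S g ∣P∣≡t w≡0 ok = ≮⇒≥ λ few →
      contradiction (trans (sym w≡0) (trans (if-yes (∣ P ∣ ≟ t) ∣P∣≡t) (∏≡1 P g _ λ {p} p∈P →
        trans (if-yes (∣ candidates (col , P , F) S (overwrite P g) ∣ <? n) few)
              (cong (if_then 1 else 0) ([]=⇒lookup
                (∈-comprehension⁺ (extendsAll? col S (overwrite P g) F) (ok p∈P))))))) λ ()

    -- `B` is the set from which the image of the next vertex is taken; `P` will be its block and
    -- `S` the images of its embedded neighbours. One `B` serves all `W`, hence all edges at that
    -- vertex and all representatives in the other blocks.
    Rich : Vec (Fin N) R → Set
    Rich g = ∀ col P (S : Vec (Fin N) d) → ∣ P ∣ ≡ t →
      ∃[ B ] n ≤ ∣ B ∣ × (∀ {y} → y ∈ B → ∀ W →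
        (∀ {p} → p ∈ P → Extends col S (overwrite P g (lookup g p)) W) →
        Extends col S (overwrite P g y) W)

    -- Fix P, S, col and let F be the family of all W that become col-coloured
    -- whichever p ∈ P supplies the common value on P.  If few y extend F, then
    -- all t coordinates in P fell into a small set determined by the others.
    rich-vector : .{{NonZero N}} → length (patterns q R d) * N ^ d * n ^ t < N ^ t →
      ∃ Rich
    rich-vector small = proj₁ avoiding , λ col P S ∣P∣≡t →
      let g = proj₁ avoiding
          good? = λ W → Fin.all? λ p → (p ∈? P) →-dec
            (c (image (lookup (S ++ overwrite P g (lookup g p))) W) Fin.≟ col)
          F = filter good? (subsets (d + R))
      in candidates (col , P , F) S (overwrite P g) ,
         weight≡0⇒many col P F S g ∣P∣≡t
           (proj₂ avoiding (∈-cartesianProduct⁺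
             (∈-cartesianProduct⁺ (∈-allFin col)
               (∈-cartesianProduct⁺ (∈-subsets P) (filter∈sublists good? (subsets (d + R)))))
             (∈-vectors ∈-allFin S)))
           (λ {p} p∈P → All.map (λ good → good p p∈P) (All.all-filter good? (subsets (d + R)))) ,
         λ y∈B W good → All.lookup (∈-comprehension⁻ (extendsAll? col S (overwrite P g) F) y∈B)
           (∈-filter⁺ good? (∈-subsets W) (λ p p∈P → good p∈P))
      where
      -- The family `F` is read off from the vector that is found, so the events to be avoided must
      -- range over all families.
      events = cartesianProduct (patterns q R d) (vectors (allFin N) d)
      length-vectors-allFin : ∀ m → length (vectors (allFin N) m) ≡ N ^ m
      length-vectors-allFin m =
        trans (length-vectors (allFin N) m) (cong (_^ m) (length-tabulate id))
      few : length events * n ^ t < N ^ t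
      few = subst (λ l → l * n ^ t < N ^ t)
        (sym (trans (length-cartesianProductWith _,_ (patterns q R d) (vectors (allFin N) d))
                    (cong (length (patterns q R d) *_) (length-vectors-allFin d))))
        small
      avoiding : ∃[ g ] (∀ {i} → i ∈ₗ events → weight i g ≡ 0)
      avoiding = union-bound events (vectors (allFin N) R) weight (N ^ t) (n ^ t) few
        {{subst NonZero (sym (length-vectors-allFin R)) (m^n≢0 N R)}} ∑-weight

-- Skeletal degeneracy

∈-skelNbhd : ∀ {n} {H : Hypergraph n} {e u v} →
             e ∈ₗ H → u ∈ e → v ∈ e → u ≢ v → u ∈ skelNbhd H v
∈-skelNbhd {H = H} {e} {u} {v} e∈H u∈e v∈e u≢v = lookup⇒[]= u _ (trans (lookup∘tabulate _ u)
  (cong₂ _∧_ (distinct (u Fin.≟ v))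
    (Equivalence.to T-≡ (any⁺ (λ e → lookup e u ∧ lookup e v) (lose e∈H (Equivalence.from T-∧
      (Equivalence.from T-≡ ([]=⇒lookup u∈e) , Equivalence.from T-≡ ([]=⇒lookup v∈e))))))))
  where
  distinct : (u≟v : Dec (u ≡ v)) → not ⌊ u≟v ⌋ ≡ true
  distinct (yes u≡v) = contradiction u≡v u≢v
  distinct (no _)    = refl

x∉p-x : ∀ {n} (p : Subset n) x → x ∉ p - x
x∉p-x (s ∷ p) (suc x) (Vec.there x∈) = x∉p-x p x x∈

-- The spare entry of S keeps Fin (suc d) inhabited, so that σ can be total.
collect : ∀ {A : Set} {n d} (p : Subset n) (φ : Fin n → A) → A → ∣ p ∣ ≤ d →
  Σ (Vec A (suc d)) λ S → Σ (Fin n → Fin (suc d)) λ σ → ∀ {x} → x ∈ p → lookup S (σ x) ≡ φ x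
collect []            φ a _  = replicate _ a , (λ ()) , λ ()
collect (outside ∷ p) φ a le with collect p (φ ∘ suc) a le
... | S , σ , eq = S , (λ { zero → zero ; (suc x) → σ x }) , λ { (Vec.there x∈p) → eq x∈p }
collect (inside ∷ p) φ a (s≤s le) with collect p (φ ∘ suc) a le
... | S , σ , eq = φ zero ∷ S , (λ { zero → zero ; (suc x) → suc (σ x) }) ,
                   λ { Vec.here → refl ; (Vec.there x∈p) → eq x∈p }

module _ {n d} {H : Hypergraph n} (degen : SkelDegenAtMost H d) where

  -- Repeatedly deleting a vertex of small degree and reversing the deletions builds up `U` in
  -- degeneracy order: each new vertex has at most `d` earlier neighbours.
  degeneracy-induction : (P : Subset n → Set) → (∀ {U} → Empty U → P U) →
    (∀ {U v} → v ∈ U → ∣ skelNbhd H v ∩ U ∣ ≤ d → P (U - v) → P U) → ∀ U → P U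
  degeneracy-induction P base step U = go ∣ U ∣ U ≤-refl
    where
    go : ∀ m U → ∣ U ∣ ≤ m → P U
    go m U le with nonempty? U
    ... | no  empty    = base empty
    go m U le | yes nonempty with degen U nonempty
    ... | v , v∈U , few with m | ≤-trans (x∈p⇒∣p-x∣<∣p∣ v∈U) le
    ... | suc m′ | s≤s le′ = step v∈U few (go m′ (U - v) le′)

  -- Greedy colouring in degeneracy order. Injectivity on every edge is properness on the skeleton.
  proper-colouring : ∃[ χ ] ∀ {e} → e ∈ₗ H → InjectiveOn {N = suc d} e χ
  proper-colouring with degeneracy-induction
      (λ U → ∃[ χ ] ∀ {e} → e ∈ₗ H → InjectiveOn {N = suc d} (e ∩ U) χ) base step ⊤
    where
    base : ∀ {U} → Empty U → ∃[ χ ] ∀ {e} → e ∈ₗ H → InjectiveOn {N = suc d} (e ∩ U) χ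
    base {U} empty = (λ _ → zero) , λ {e} _ x∈ → contradiction (_ , proj₂ (x∈p∩q⁻ e U x∈)) empty
    step : ∀ {U v} → v ∈ U → ∣ skelNbhd H v ∩ U ∣ ≤ d →
      ∃[ χ ] (∀ {e} → e ∈ₗ H → InjectiveOn {N = suc d} (e ∩ (U - v)) χ) →
      ∃[ χ ] ∀ {e} → e ∈ₗ H → InjectiveOn {N = suc d} (e ∩ U) χ
    step {U} {v} v∈U few (χ , inj)
      -- The earlier neighbours of `v` use at most `d` of the `suc d` colours, so some colour `a` is
      -- free.
      with a , _ , a∉ ← ∣p∣<∣q∣⇒q⊈p (image χ (skelNbhd H v ∩ U)) ⊤
        (≤-<-trans (≤-trans (∣image∣≤∣e∣ χ (skelNbhd H v ∩ U)) few)
                   (≤-reflexive (sym (∣⊤∣≡n (suc d))))) = χ′ , inj′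
      where
      χ′ = λ u → if ⌊ u Fin.≟ v ⌋ then a else χ u
      fresh : ∀ {e x} → e ∈ₗ H → x ∈ e ∩ U → v ∈ e ∩ U → x ≢ v → a ≢ χ x
      fresh {e} e∈H x∈ v∈ x≢v refl = a∉ (∈-image⁺ χ {skelNbhd H v ∩ U} (x∈p∩q⁺
        (∈-skelNbhd e∈H (proj₁ (x∈p∩q⁻ e U x∈)) (proj₁ (x∈p∩q⁻ e U v∈)) x≢v ,
         proj₂ (x∈p∩q⁻ e U x∈))))
      shrink : ∀ {e x} → x ∈ e ∩ U → x ≢ v → x ∈ e ∩ (U - v)
      shrink {e} x∈ x≢v with x∈p∩q⁻ e U x∈
      ... | x∈e , x∈U = x∈p∩q⁺ (x∈e , x∈p∧x≢y⇒x∈p-y x∈U x≢v)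
      inj′ : ∀ {e} → e ∈ₗ H → InjectiveOn (e ∩ U) χ′
      inj′ e∈H {x} {y} x∈ y∈ eq with x Fin.≟ v | y Fin.≟ v
      ... | yes refl | yes refl = refl
      ... | yes refl | no  y≢v  = contradiction eq (fresh e∈H y∈ x∈ y≢v)
      ... | no  x≢v  | yes refl = contradiction (sym eq) (fresh e∈H x∈ y∈ x≢v)
      ... | no  x≢v  | no  y≢v  = inj e∈H (shrink x∈ x≢v) (shrink y∈ y≢v) eq
  ... | χ , inj = χ , λ {e} e∈H x∈ y∈ → inj e∈H (x∈p∩q⁺ (x∈ , ∈⊤)) (x∈p∩q⁺ (y∈ , ∈⊤))

-- Embedding

∉⇒lookup : ∀ {m} {p : Subset m} {x} → x ∉ p → lookup p x ≡ outside
∉⇒lookup {p = p} {x} x∉p with lookup p x in eq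
... | inside  = contradiction (lookup⇒[]= x p eq) x∉p
... | outside = refl

-- Richness is taken for tuples of length `suc d`, to match the vectors that `collect` pads by one
-- entry.
module Embedding {q N n k d t R : ℕ} (c : Subset N → Fin q) {H : Hypergraph n}
  (uniform : Uniform k H) (degen : SkelDegenAtMost H d)
  (y₀ : Fin N) {g : Vec (Fin N) R} (rich : Rich c R (suc d) n t g)
  {col : Fin q} (o : OPE (suc d * t) R)
  (homogeneous : ∀ W → ∣ W ∣ ≡ k → c (image (lookup g) (act o W)) ≡ col) where

  χ : Fin n → Fin (suc d)
  χ = proj₁ (proper-colouring {H = H} degen)

  χ-injectiveOn : ∀ {e} → e ∈ₗ H → InjectiveOn e χ
  χ-injectiveOn = proj₂ (proper-colouring {H = H} degen)

  -- `combine` cuts the homogeneous set of (d+1)t coordinates into blocks of size `t`, one for each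
  -- colour of `χ`.
  place : Fin (suc d) → Fin t → Fin R
  place a i = index o (combine a i)

  place-injectiveˡ : ∀ {a b} i j → place a i ≡ place b j → a ≡ b
  place-injectiveˡ {a} {b} i j eq = Fin.combine-injectiveˡ a i b j (index-injective o eq)

  block : Fin (suc d) → Subset R
  block a = image (place a) ⊤

  ∣block∣ : ∀ a → ∣ block a ∣ ≡ t
  ∣block∣ a = trans (∣image∣≡∣e∣ (place a) ⊤ injective) (∣⊤∣≡n t)
    where
    injective : InjectiveOn ⊤ (place a)
    injective {i} {j} _ _ eq = Fin.combine-injectiveʳ a i a j (index-injective o eq)

  slot : (Fin (suc d) → Fin t) → Fin n → Fin R
  slot τ x = place (χ x) (τ (χ x))

  mixed : Subset n → (Fin n → Fin N) → (Fin (suc d) → Fin t) → Fin n → Fin N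
  mixed U φ τ x = if ⌊ x ∈? U ⌋ then φ x else lookup g (slot τ x)

  -- The vertices outside U still range over whole blocks of g, one
  -- representative per colour class.
  PartialCopy : Subset n → Set
  PartialCopy U = ∃[ φ ] InjectiveOn {N = N} U φ ×
    (∀ τ {e} → e ∈ₗ H → c (image (mixed U φ τ) e) ≡ col)

  -- With nothing embedded, each edge is sent into the homogeneous set; its vertices lie in
  -- different blocks, so it becomes a set of exactly `k` coordinates.
  start : ∀ {U} → Empty U → PartialCopy U
  start {U} empty = (λ _ → y₀) , (λ x∈U → contradiction (_ , x∈U) empty) , λ τ {e} e∈H →
    let f = λ x → combine (χ x) (τ (χ x)) in
    trans (cong c (begin
      image (mixed U (λ _ → y₀) τ) e
        ≡⟨ image-cong e (λ {x} _ → if-no (x ∈? U) λ x∈U → empty (x , x∈U)) ⟩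
      image (lookup g ∘ index o ∘ f) e
        ≡⟨ image-∘ (lookup g) (index o ∘ f) e ⟩
      image (lookup g) (image (index o ∘ f) e)
        ≡⟨ cong (image (lookup g)) (image-∘ (index o) f e) ⟩
      image (lookup g) (image (index o) (image f e))
        ≡⟨ cong (image (lookup g)) (act≡image o (image f e)) ⟨
      image (lookup g) (act o (image f e)) ∎))
    (homogeneous (image f e) (trans
      (∣image∣≡∣e∣ f e λ {x} {y} x∈e y∈e eq →
        χ-injectiveOn e∈H x∈e y∈e (Fin.combine-injectiveˡ (χ x) _ (χ y) _ eq))
      (All.lookup uniform e∈H)))
    where open ≡-Reasoning

  module Extension {U v} (v∈U : v ∈ U) {φ : Fin n → Fin N} (φ-inj : InjectiveOn (U - v) φ)
    (φ-mono : ∀ τ {e} → e ∈ₗ H → c (image (mixed (U - v) φ τ) e) ≡ col)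
    {S : Vec (Fin N) (suc d)} {σ : Fin n → Fin (suc d)}
    (S∘σ : ∀ {x} → x ∈ skelNbhd H v ∩ U → lookup S (σ x) ≡ φ x)
    {y : Fin N} (y∉ : y ∉ image φ (U - v))
    (y-extends : ∀ W →
      (∀ {p} → p ∈ block (χ v) →
        Extends c R (suc d) col S (overwrite (block (χ v)) g (lookup g p)) W) →
      Extends c R (suc d) col S (overwrite (block (χ v)) g y) W) where

    φ′ : Fin n → Fin N
    φ′ x = if ⌊ x Fin.≟ v ⌋ then y else φ x

    φ-avoids-y : ∀ {x} → x ∈ U → x ≢ v → φ x ≢ y
    φ-avoids-y x∈U x≢v eq =
      y∉ (subst (_∈ image φ (U - v)) eq (∈-image⁺ φ (x∈p∧x≢y⇒x∈p-y x∈U x≢v)))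

    φ′-inj : InjectiveOn U φ′
    φ′-inj {x} {z} x∈ z∈ eq with x Fin.≟ v | z Fin.≟ v
    ... | yes refl | yes refl = refl
    ... | yes refl | no  z≢v  = contradiction (sym eq) (φ-avoids-y z∈ z≢v)
    ... | no  x≢v  | yes refl = contradiction eq (φ-avoids-y x∈ x≢v)
    ... | no  x≢v  | no  z≢v  = φ-inj (x∈p∧x≢y⇒x∈p-y x∈ x≢v) (x∈p∧x≢y⇒x∈p-y z∈ z≢v) eq

    v∉U-v : v ∉ U - v
    v∉U-v = x∉p-x U v

    ∈-restore : ∀ {x} → x ∈ U - v → x ∈ U
    ∈-restore = p─q⊆p U _

    -- Interpolates between the two stages: a value `z` from the block of `v` gives back the old
    -- mixed map on edges through `v`, and `z` = `y` gives the new one.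
    filled : Fin N → (Fin (suc d) → Fin t) → Fin n → Fin N
    filled z τ x = if ⌊ x Fin.≟ v ⌋ then z else mixed (U - v) φ τ x

    -- Embedded vertices are looked up in `S`, the others and `v` itself at their slots in `g`. The
    -- value of `σ` is meaningful only at neighbours of `v`, which is enough on edges through `v`.
    position : (Fin (suc d) → Fin t) → Fin n → Fin (suc d + R)
    position τ x = if ⌊ x ∈? (U - v) ⌋ then σ x ↑ˡ R else suc d ↑ʳ slot τ x

    -- `χ` is injective on `e`, so overwriting the block of `v` affects no other vertex of `e`.
    slot∈⁻ : ∀ τ {e x} → e ∈ₗ H → v ∈ e → x ∈ e → slot τ x ∈ block (χ v) → x ≡ v
    slot∈⁻ τ e∈H v∈e x∈e slot∈ with i , _ , eq ← ∈-image⁻ (place (χ v)) {⊤} slot∈ =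
      sym (χ-injectiveOn e∈H v∈e x∈e (place-injectiveˡ i _ eq))

    lookup-position : ∀ z τ {e x} → e ∈ₗ H → v ∈ e → x ∈ e →
      lookup (S ++ overwrite (block (χ v)) g z) (position τ x) ≡ filled z τ x
    lookup-position z τ {e} {x} e∈H v∈e x∈e = go (x Fin.≟ v) (x ∈? (U - v))
      where
      open ≡-Reasoning
      pool = S ++ overwrite (block (χ v)) g z
      at-slot : x ∉ U - v → lookup pool (position τ x) ≡
                (if lookup (block (χ v)) (slot τ x) then z else lookup g (slot τ x))
      at-slot x∉ = begin
        lookup pool (position τ x)
          ≡⟨ cong (lookup pool) (if-no (x ∈? (U - v)) x∉) ⟩
        lookup pool (suc d ↑ʳ slot τ x)
          ≡⟨ lookup-++ʳ S _ (slot τ x) ⟩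
        lookup (overwrite (block (χ v)) g z) (slot τ x)
          ≡⟨ lookup-zipWith _ (slot τ x) (block (χ v)) g ⟩
        (if lookup (block (χ v)) (slot τ x) then z else lookup g (slot τ x)) ∎
      own-slot : lookup (block (χ v)) (slot τ v) ≡ inside
      own-slot = []=⇒lookup (∈-image⁺ (place (χ v)) {⊤} ∈⊤)
      other-slot : x ≢ v → lookup (block (χ v)) (slot τ x) ≡ outside
      other-slot x≢v = ∉⇒lookup (x≢v ∘ slot∈⁻ τ e∈H v∈e x∈e)
      go : Dec (x ≡ v) → Dec (x ∈ U - v) → lookup pool (position τ x) ≡ filled z τ x
      go (yes refl) _ = begin
        lookup pool (position τ v) ≡⟨ at-slot v∉U-v ⟩
        _                          ≡⟨ cong (if_then z else lookup g (slot τ v)) own-slot ⟩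
        z                          ≡⟨ if-yes (v Fin.≟ v) refl ⟨
        filled z τ v               ∎
      go (no x≢v) (yes x∈) = begin
        lookup pool (position τ x) ≡⟨ cong (lookup pool) (if-yes (x ∈? (U - v)) x∈) ⟩
        lookup pool (σ x ↑ˡ R)     ≡⟨ lookup-++ˡ S _ (σ x) ⟩
        lookup S (σ x)             ≡⟨ S∘σ (x∈p∩q⁺ (∈-skelNbhd e∈H x∈e v∈e x≢v , ∈-restore x∈)) ⟩
        φ x                        ≡⟨ if-yes (x ∈? (U - v)) x∈ ⟨
        mixed (U - v) φ τ x        ≡⟨ if-no (x Fin.≟ v) x≢v ⟨
        filled z τ x               ∎
      go (no x≢v) (no x∉) = begin
        lookup pool (position τ x) ≡⟨ at-slot x∉ ⟩
        _                          ≡⟨ cong (if_then z else lookup g (slot τ x)) (other-slot x≢v) ⟩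
        lookup g (slot τ x)        ≡⟨ if-no (x ∈? (U - v)) x∉ ⟨
        mixed (U - v) φ τ x        ≡⟨ if-no (x Fin.≟ v) x≢v ⟨
        filled z τ x               ∎

    -- Sending `v` to another member of its block amounts to changing `τ` at `χ v`, since no other
    -- vertex of `e` draws on that block.
    filled-own : ∀ τ i {e x} → e ∈ₗ H → v ∈ e → x ∈ e →
      filled (lookup g (place (χ v) i)) τ x ≡ mixed (U - v) φ (updateAt τ (χ v) (λ _ → i)) x
    filled-own τ i {e} {x} e∈H v∈e x∈e with x Fin.≟ v
    ... | yes refl = sym (trans (if-no (v ∈? (U - v)) v∉U-v)
                       (cong (lookup g ∘ place (χ v)) (updateAt-updates (χ v) τ)))
    ... | no  x≢v = cong (λ j → if ⌊ x ∈? (U - v) ⌋ then φ x else lookup g (place (χ x) j))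
                      (sym (updateAt-minimal (χ x) (χ v) τ (x≢v ∘ χ-injectiveOn e∈H x∈e v∈e)))

    filled-new : ∀ τ x → filled y τ x ≡ mixed U φ′ τ x
    filled-new τ x with x Fin.≟ v
    ... | yes refl = sym (if-yes (v ∈? U) v∈U)
    ... | no  x≢v with x ∈? U
    ...   | yes x∈U = if-yes (x ∈? (U - v)) (x∈p∧x≢y⇒x∈p-y x∈U x≢v)
    ...   | no  x∉U = if-no (x ∈? (U - v)) (x∉U ∘ ∈-restore)

    -- Edges avoiding `v` look the same as before. For an edge through `v`, the old invariant gives
    -- colour `col` for every member of the block in the place of `v`, and richness passes this on
    -- to `y`.
    φ′-mono : ∀ τ {e} → e ∈ₗ H → c (image (mixed U φ′ τ) e) ≡ col
    φ′-mono τ {e} e∈H with v ∈? e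
    ... | no v∉e = trans (cong c (image-cong e λ {x} x∈e →
            trans (sym (filled-new τ x)) (if-no (x Fin.≟ v) λ { refl → v∉e x∈e })))
          (φ-mono τ e∈H)
    ... | yes v∈e = trans
        (cong c (trans (image-cong e (λ {x} _ → sym (filled-new τ x))) (sym (image-position y))))
        (y-extends (image (position τ) e) own)
      where
      image-position : ∀ z →
        image (lookup (S ++ overwrite (block (χ v)) g z)) (image (position τ) e) ≡
        image (filled z τ) e
      image-position z =
        trans (sym (image-∘ _ (position τ) e)) (image-cong e (lookup-position z τ e∈H v∈e))
      own : ∀ {p} → p ∈ block (χ v) →
        Extends c R (suc d) col S (overwrite (block (χ v)) g (lookup g p)) (image (position τ) e)
      own p∈ with i , _ , refl ← ∈-image⁻ (place (χ v)) {⊤} p∈ =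
        trans (cong c (trans (image-position _) (image-cong e (filled-own τ i e∈H v∈e))))
          (φ-mono (updateAt τ (χ v) (λ _ → i)) e∈H)

  extend : ∀ {U v} → v ∈ U → ∣ skelNbhd H v ∩ U ∣ ≤ d → PartialCopy (U - v) → PartialCopy U
  extend {U} {v} v∈U few (φ , φ-inj , φ-mono) =
    let S , σ , S∘σ = collect (skelNbhd H v ∩ U) φ y₀ few
        B , n≤∣B∣ , B-extends = rich col (block (χ v)) S (∣block∣ (χ v))
        -- Fewer than `n` vertices of the host are occupied so far, so `B` contains a free one.
        y , y∈B , y∉ = ∣p∣<∣q∣⇒q⊈p (image φ (U - v)) B
          (≤-trans (≤-<-trans (∣image∣≤∣e∣ φ (U - v)) (x∈p⇒∣p-x∣<∣p∣ v∈U))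
                   (≤-trans (∣p∣≤n U) n≤∣B∣))
        open Extension v∈U φ-inj φ-mono {S} {σ} S∘σ y∉ (B-extends y∈B)
    in φ′ , φ′-inj , φ′-mono

  -- For `U` = `⊤` the mixed map is `φ` itself; the argument supplies a constant `τ` at which to
  -- read the invariant.
  monochromaticCopy : Fin t →
    Σ (Fin n → Fin N) (λ f → Injective _≡_ _≡_ f × All (λ e → c (image f e) ≡ col) H)
  monochromaticCopy i with degeneracy-induction {H = H} degen PartialCopy start extend ⊤
  ... | φ , inj , mono = φ , inj ∈⊤ ∈⊤ , All.tabulate λ {e} e∈H →
    trans (cong c (image-cong e (λ {x} _ → sym (if-yes (x ∈? ⊤) ∈⊤)))) (mono (λ _ → i) e∈H)

-- Integer roots and the choice of parameters

^-distribʳ-* : ∀ o m n → (m * n) ^ o ≡ m ^ o * n ^ o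
^-distribʳ-* zero    m n = refl
^-distribʳ-* (suc o) m n =
  trans (cong (m * n *_) (^-distribʳ-* o m n)) (*-interchange m n (m ^ o) (n ^ o))

integer-root : ∀ m .{{_ : NonZero m}} n → ∃[ s ] s ^ m ≤ n × n < suc s ^ m
integer-root m@(suc _) zero = 0 , z≤n , m^n>0 1 m
integer-root m (suc n) with integer-root m n
... | s , lower , upper with suc n <? suc s ^ m
...   | yes below = s , m≤n⇒m≤1+n lower , below
...   | no  above = suc s , ≮⇒≥ above , ≤-<-trans upper (^-monoˡ-< m (n<1+n (suc s)))

-- The vector `g` is fixed first and the blocks are found inside it afterwards, which is why
-- richness speaks of all t-sets of coordinates.
arrows : ∀ {q k d t R n N} → Ramsey q k (suc d * t) R → .{{NonZero N}} → .{{NonZero t}} →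
  length (patterns q R (suc d)) * N ^ suc d * n ^ t < N ^ t →
  (H : Hypergraph n) → Uniform k H → SkelDegenAtMost H d → Arrows q k N H
arrows {d = d} {t@(suc _)} {R} {n} {suc _} ramseyR small H uniform degen c =
  let g , rich = rich-vector c R (suc d) n t small
      -- `g` may repeat values, so a k-set of coordinates may have a smaller image. This is
      -- harmless: `c` is defined on all subsets, and the final embedding is injective.
      col , o , homogeneous = ramseyR (c ∘ image (lookup g))
      f , injective , mono =
        Embedding.monochromaticCopy c uniform degen zero rich o homogeneous zero
  in f , injective , col , mono

theorem4p1 : (k d q : ℕ) → 2 ≤ k → 2 ≤ d → 2 ≤ q →
    (m : ℕ) → 1 ≤ m →
    Σ ℕ (λ n₀ → (n : ℕ) → n₀ ≤ n →
    (H : Hypergraph n) → Uniform k H → SkelDegeneracy H d →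
    Σ ℕ (λ M → M ^ m ≤ n ^ (m + 1) × RamseyAtMost q k H M))
-- With N = n s and s = ⌊n^(1/m)⌋, t is chosen such that n^D ≤ (2s)^(mD) is
-- absorbed into s^t with one factor s left over, which beats the constant K.
theorem4p1 k d (suc q) _ _ _ m@(suc _) _ = suc K ^ m , bound
  where
  D = suc d
  t = suc (m * D + D)
  R = proj₁ (ramsey q k (D * t))
  C = length (patterns (suc q) R D)
  K = C * 2 ^ (m * D)

  bound : ∀ n → suc K ^ m ≤ n → (H : Hypergraph n) → Uniform k H → SkelDegeneracy H d →
          Σ ℕ (λ M → M ^ m ≤ n ^ (m + 1) × RamseyAtMost (suc q) k H M)
  bound n n₀≤n H uniform (degen , _) with integer-root m n
  ... | s , lower , upper = n * s , upper-bound , n * s , ≤-refl ,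
      arrows {d = d} (proj₂ (ramsey q k (D * t))) {{N≢0}} small H uniform degen
    where
    open ≤-Reasoning

    -- This is n s ≤ n^(1+1/m), raised to the power m to stay within the integers.
    upper-bound : (n * s) ^ m ≤ n ^ (m + 1)
    upper-bound = begin
      (n * s) ^ m     ≡⟨ ^-distribʳ-* m n s ⟩
      n ^ m * s ^ m   ≤⟨ *-monoʳ-≤ (n ^ m) lower ⟩
      n ^ m * n       ≡⟨ *-comm (n ^ m) n ⟩
      n ^ suc m       ≡⟨ cong (n ^_) (+-comm 1 m) ⟩
      n ^ (m + 1)     ∎

    -- Otherwise n < (s+1)^m ≤ (K+1)^m, against the choice of the threshold.
    K<s : K < s
    K<s = ≮⇒≥ λ s<1+K → <-irrefl refl (<-≤-trans upper (≤-trans (^-monoˡ-≤ m s<1+K) n₀≤n))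

    n>0 : 0 < n
    n>0 = <-≤-trans (m^n>0 (suc K) m) n₀≤n

    instance
      n≢0 : NonZero n
      n≢0 = >-nonZero n>0
      s≢0 : NonZero s
      s≢0 = >-nonZero (≤-<-trans z≤n K<s)
      N≢0 : NonZero (n * s)
      N≢0 = m*n≢0 n s

    n≤[2s]^m : n ≤ (2 * s) ^ m
    n≤[2s]^m = ≤-trans (<⇒≤ upper) (^-monoˡ-≤ m (begin
      suc s       ≤⟨ +-monoˡ-≤ s (≤-<-trans z≤n K<s) ⟩
      s + s       ≡⟨ cong (s +_) (+-identityʳ s) ⟨
      2 * s       ∎))

    n^D≤ : n ^ D ≤ 2 ^ (m * D) * s ^ (m * D)
    n^D≤ = begin
      n ^ D                       ≤⟨ ^-monoˡ-≤ D n≤[2s]^m ⟩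
      ((2 * s) ^ m) ^ D           ≡⟨ ^-*-assoc (2 * s) m D ⟩
      (2 * s) ^ (m * D)           ≡⟨ ^-distribʳ-* (m * D) 2 s ⟩
      2 ^ (m * D) * s ^ (m * D)   ∎

    small : C * (n * s) ^ D * n ^ t < (n * s) ^ t
    small = begin-strict
      C * (n * s) ^ D * n ^ t
        ≡⟨ cong (λ x → C * x * n ^ t) (^-distribʳ-* D n s) ⟩
      C * (n ^ D * s ^ D) * n ^ t
        ≤⟨ *-monoˡ-≤ (n ^ t) (*-monoʳ-≤ C (*-monoˡ-≤ (s ^ D) n^D≤)) ⟩
      C * (2 ^ (m * D) * s ^ (m * D) * s ^ D) * n ^ t
        ≡⟨ cong (_* n ^ t)
             (solve 4 (λ C x y z → C :* (x :* y :* z) := C :* x :* (y :* z)) refl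
               C (2 ^ (m * D)) (s ^ (m * D)) (s ^ D)) ⟩
      K * (s ^ (m * D) * s ^ D) * n ^ t
        ≡⟨ cong (λ x → K * x * n ^ t) (^-distribˡ-+-* s (m * D) D) ⟨
      K * s ^ (m * D + D) * n ^ t
        -- As `t` is a successor, `s ^ t` unfolds to `s` times `s ^ (m * D + D)`; this spare factor
        -- replaces `K`.
        <⟨ *-monoˡ-< (n ^ t) {{m^n≢0 n t}}
             (*-monoˡ-< (s ^ (m * D + D)) {{m^n≢0 s (m * D + D)}} K<s) ⟩
      s ^ t * n ^ t
        ≡⟨ *-comm (s ^ t) (n ^ t) ⟩
      n ^ t * s ^ t
        ≡⟨ ^-distribʳ-* t n s ⟨
      (n * s) ^ t ∎
      where open +-*-Solver
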